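{- Let $M$ be a matroid with an adjoint map $\phi$ to $M'$, and let $C\subseteq E(M)$. Then there is an adjoint map $\phi_{/C}$ from $M/C$ to $M'|\phi(\mathrm{cl}_M(C))$ given by $\phi_{/C}(F)=\phi(F\cup C)$ for each flat $F\in\mathcal{F}(M/C)$.
   Context: Matroid terminology follows Oxley's book; in particular matroids are finite. $E(M)$ is the ground set of $M$, $\mathrm{cl}_M$ is its closure operator, $\mathcal{F}(M)$ is the collection of flats of $M$, $M/C$ is contraction, and $M'|X$ is the restriction of $M'$ to $X$. A set $F\subseteq E(M)-C$ is a flat of $M/C$ if and only if $F\cup C$ is a flat of $M$. A hyperplane of $M$ is a flat of rank $r(M)-1$; a point is a flat of rank $1$ (in a simple matroid, the points are exactly the singletons of elements of the ground set, and are identified with the elements). Definition. Let $M$ be a matroid, and let $M'$ be a simple matroid with the same rank as $M$. Then $M'$ is an adjoint of $M$ if there is a map $\phi:\mathcal{F}(M)\rightarrow\mathcal{F}(M')$ such that (i) $\phi$ is injective; (ii) if $F_1,F_2\in\mathcal{F}(M)$ and $F_1\subseteq F_2$, then $\phi(F_2)\subseteq\phi(F_1)$; and (iii) $\phi$ restricts to a bijection from the set of hyperplanes of $M$ onto the set of points of $M'$. Such a map $\phi$ is called an adjoint map from $M$ to $M'$. (Thus saying that there is an adjoint map from one matroid to another includes that the second matroid is simple and has the same rank as the first.) -}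

module Defs where

open import Data.Empty using (⊥-elim)
open import Data.Fin using (Fin)
open import Data.Fin.Properties using (any?)
open import Data.Fin.Subset
open import Data.Fin.Subset.Induction using (⊃-wellFounded)
open import Data.Fin.Subset.Properties
open import Data.Nat using (ℕ; suc; _+_; _≤_; _<_; _≟_)
open import Data.Nat.Properties
  using (≤-refl; ≤-trans; ≤-antisym; ≤-reflexive; <-irrefl; <-≤-trans; ≮⇒≥; +-mono-≤;
         +-monoˡ-<; +-cancelˡ-<; +-suc; module ≤-Reasoning)
open import Data.Product using (∃; ∃-syntax; _×_; _,_; proj₁; proj₂)
open import Data.Sum using (_⊎_; inj₁; inj₂)
open import Data.Vec using ([]; _∷_; here; there; tabulate)
open import Data.Vec.Properties using (lookup∘tabulate; []=⇒lookup; lookup⇒[]=)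
open import Function using (_∘_)
open import Function.Definitions using (Injective; Bijective)
open import Induction.WellFounded using (Acc; acc)
open import Relation.Binary.PropositionalEquality
  using (_≡_; _≢_; refl; sym; trans; cong; subst)
open import Relation.Nullary using (¬_; Dec; yes; no; does)
open import Relation.Nullary.Decidable using (¬?; _×-dec_; map′; dec-true)
open import Relation.Unary using (Pred; Decidable)
open import Level using (0ℓ)

private
  variable
    n : ℕ

∣p∣≡∣p∩q∣+∣p─q∣ : (p q : Subset n) → ∣ p ∣ ≡ ∣ p ∩ q ∣ + ∣ p ─ q ∣
∣p∣≡∣p∩q∣+∣p─q∣ [] [] = refl
∣p∣≡∣p∩q∣+∣p─q∣ (inside ∷ p) (inside ∷ q) = cong suc (∣p∣≡∣p∩q∣+∣p─q∣ p q)
∣p∣≡∣p∩q∣+∣p─q∣ (inside ∷ p) (outside ∷ q) =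
  trans (cong suc (∣p∣≡∣p∩q∣+∣p─q∣ p q)) (sym (+-suc ∣ p ∩ q ∣ ∣ p ─ q ∣))
∣p∣≡∣p∩q∣+∣p─q∣ (outside ∷ p) (inside ∷ q) = ∣p∣≡∣p∩q∣+∣p─q∣ p q
∣p∣≡∣p∩q∣+∣p─q∣ (outside ∷ p) (outside ∷ q) = ∣p∣≡∣p∩q∣+∣p─q∣ p q

x∈p─q⁻ : ∀ {x : Fin n} (p q : Subset n) → x ∈ p ─ q → x ∈ p × x ∉ q
x∈p─q⁻ p q x∈ = p─q⊆p p q x∈ , λ x∈q → disjoint p q x∈ x∈q
  where
  disjoint : ∀ {k} {y : Fin k} (p q : Subset k) → y ∈ p ─ q → ¬ y ∈ q
  disjoint (_ ∷ _) (inside ∷ _) () here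
  disjoint (_ ∷ p) (_ ∷ q) (there a) (there b) = disjoint p q a b

∪-lub : ∀ {p q s : Subset n} → p ⊆ s → q ⊆ s → p ∪ q ⊆ s
∪-lub {p = p} {q} p⊆s q⊆s x∈ with x∈p∪q⁻ p q x∈
... | inj₁ x∈p = p⊆s x∈p
... | inj₂ x∈q = q⊆s x∈q

⁅x⁆⊆ : ∀ {x : Fin n} {p : Subset n} → x ∈ p → ⁅ x ⁆ ⊆ p
⁅x⁆⊆ {x = x} {p} x∈p y∈ = subst (_∈ p) (sym (x∈⁅y⁆⇒x≡y x y∈)) x∈p

∉⇒⊂ : ∀ {x : Fin n} {p : Subset n} → x ∉ p → p ⊂ p ∪ ⁅ x ⁆
∉⇒⊂ {x = x} {p} x∉p = p⊆p∪q ⁅ x ⁆ , x , q⊆p∪q p ⁅ x ⁆ (x∈⁅x⁆ x) , x∉p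

-- A finite matroid given by its independent sets.  The ground set is a
-- subset E of Fin n, so that minors of M live over the same index type.
-- Indep? makes the predicate a collection of subsets in the classical sense.

record Matroid (n : ℕ) : Set₁ where
  field
    E       : Subset n
    Indep   : Pred (Subset n) 0ℓ
    Indep?  : Decidable Indep
    indep⊆E : ∀ {I} → Indep I → I ⊆ E
    indep-∅ : Indep ⊥
    indep-↓ : ∀ {I J} → I ⊆ J → Indep J → Indep I
    augment : ∀ {I J} → Indep I → Indep J → ∣ I ∣ < ∣ J ∣ →
              ∃[ e ] e ∈ J × e ∉ I × Indep (I ∪ ⁅ e ⁆)

  IsBasisOf : Subset n → Subset n → Set
  IsBasisOf X B = B ⊆ X × Indep B × (∀ {J} → J ⊆ X → Indep J → B ⊆ J → J ⊆ B)

  IsBase : Subset n → Set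
  IsBase = IsBasisOf E

  extend : ∀ {X I} → I ⊆ X → Indep I → ∃[ B ] I ⊆ B × IsBasisOf X B
  extend {X} {I} = go I (⊃-wellFounded I)
    where
    go : ∀ I → Acc _⊃_ I → I ⊆ X → Indep I → ∃[ B ] I ⊆ B × IsBasisOf X B
    go I (acc rec) I⊆X indI
      with any? (λ x → (x ∈? X) ×-dec (¬? (x ∈? I) ×-dec Indep? (I ∪ ⁅ x ⁆)))
    ... | yes (x , x∈X , x∉I , ind) =
      let B , I∪x⊆B , isB = go (I ∪ ⁅ x ⁆) (rec (∉⇒⊂ x∉I)) (∪-lub I⊆X (⁅x⁆⊆ x∈X)) ind
      in  B , (I∪x⊆B ∘ p⊆p∪q ⁅ x ⁆) , isB
    ... | no none = I , (λ x∈ → x∈) , I⊆X , indI , maximal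
      where
      maximal : ∀ {J} → J ⊆ X → Indep J → I ⊆ J → J ⊆ I
      maximal J⊆X indJ I⊆J {x} x∈J with x ∈? I
      ... | yes x∈I = x∈I
      ... | no  x∉I =
        ⊥-elim (none (x , J⊆X x∈J , x∉I , indep-↓ (∪-lub I⊆J (⁅x⁆⊆ x∈J)) indJ))

  indep≤basis : ∀ {X B I} → IsBasisOf X B → I ⊆ X → Indep I → ∣ I ∣ ≤ ∣ B ∣
  indep≤basis {X} {B} {I} (B⊆X , indB , max) I⊆X indI = ≮⇒≥ λ B<I →
    let e , e∈I , e∉B , ind = augment indB indI B<I
    in  e∉B (max (∪-lub B⊆X (⁅x⁆⊆ (I⊆X e∈I))) ind (p⊆p∪q ⁅ e ⁆)
                 (q⊆p∪q B ⁅ e ⁆ (x∈⁅x⁆ e)))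

  basis-size : ∀ {X B B′} → IsBasisOf X B → IsBasisOf X B′ → ∣ B ∣ ≡ ∣ B′ ∣
  basis-size b@(B⊆X , indB , _) b′@(B′⊆X , indB′ , _) =
    ≤-antisym (indep≤basis b′ B⊆X indB) (indep≤basis b B′⊆X indB′)

  IsBase? : Decidable IsBase
  IsBase? B = map′ to from
    ((B ⊆? E) ×-dec (Indep? B ×-dec
      ¬? (anySubset? λ J → Indep? J ×-dec ((B ⊆? J) ×-dec ¬? (J ⊆? B)))))
    where
    to : B ⊆ E × Indep B × ¬ (∃[ J ] Indep J × B ⊆ J × J ⊈ B) → IsBase B
    to (B⊆E , indB , none) = B⊆E , indB , max
      where
      max : ∀ {J} → J ⊆ E → Indep J → B ⊆ J → J ⊆ B
      max {J} _ indJ B⊆J with J ⊆? B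
      ... | yes J⊆B = J⊆B
      ... | no  J⊈B = ⊥-elim (none (J , indJ , B⊆J , J⊈B))
    from : IsBase B → B ⊆ E × Indep B × ¬ (∃[ J ] Indep J × B ⊆ J × J ⊈ B)
    from (B⊆E , indB , max) = B⊆E , indB ,
      λ (J , indJ , B⊆J , J⊈B) → J⊈B (max (indep⊆E indJ) indJ B⊆J)

  abstract
    basis : ∀ X → ∃ (IsBasisOf X)
    basis X = let B , _ , isB = extend {X} (⊥-elim ∘ ∉⊥) indep-∅ in B , isB

  -- Independent of the chosen basis by basis-size.
  r : Subset n → ℕ
  r X = ∣ proj₁ (basis X) ∣

  rank : ℕ
  rank = r E

  cl : Subset n → Subset n
  cl X = tabulate λ x → does ((x ∈? E) ×-dec (r (X ∪ ⁅ x ⁆) ≟ r X))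

  -- A flat is automatically contained in E, because cl X is.  Proofs of
  -- IsFlat, IsHyperplane and IsPoint are equalities in types with decidable
  -- equality, hence unique, so _≡_ on Flat is equality of underlying sets.
  IsFlat : Subset n → Set
  IsFlat F = cl F ≡ F

  Flat : Set
  Flat = ∃ IsFlat

  set : Flat → Subset n
  set = proj₁

  IsHyperplane : Flat → Set
  IsHyperplane H = suc (r (set H)) ≡ rank

  IsPoint : Flat → Set
  IsPoint P = r (set P) ≡ 1

  IsCircuit : Subset n → Set
  IsCircuit C = C ⊆ E × ¬ Indep C × (∀ {D} → D ⊂ C → Indep D)

  IsLoop : Fin n → Set
  IsLoop e = IsCircuit ⁅ e ⁆

  Parallel : Fin n → Fin n → Set
  Parallel e f = e ≢ f × IsCircuit (⁅ e ⁆ ∪ ⁅ f ⁆)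

  Simple : Set
  Simple = (∀ e → ¬ IsLoop e) × (∀ e f → ¬ Parallel e f)

  indep≤r : ∀ {X I} → I ⊆ X → Indep I → ∣ I ∣ ≤ r X
  indep≤r {X} = indep≤basis (proj₂ (basis X))

  r-mono : ∀ {X Y} → (∀ {x} → x ∈ E → x ∈ X → x ∈ Y) → r X ≤ r Y
  r-mono {X} X⊆Y = let B , B⊆X , indB , _ = basis X in
    indep≤r (λ x∈B → X⊆Y (indep⊆E indB x∈B) (B⊆X x∈B)) indB

  ∈cl⁻ : ∀ {X x} → x ∈ cl X → x ∈ E × r (X ∪ ⁅ x ⁆) ≡ r X
  ∈cl⁻ {X} {x} x∈ = go ((x ∈? E) ×-dec (r (X ∪ ⁅ x ⁆) ≟ r X))
                       (trans (sym (lookup∘tabulate _ x)) ([]=⇒lookup x∈))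
    where
    go : ∀ {P : Set} (d : Dec P) → does d ≡ inside → P
    go (yes p) _ = p

  ∈cl⁺ : ∀ {X x} → x ∈ E → r (X ∪ ⁅ x ⁆) ≡ r X → x ∈ cl X
  ∈cl⁺ {X} {x} x∈E eq = lookup⇒[]= x (cl X)
    (trans (lookup∘tabulate _ x) (dec-true ((x ∈? E) ×-dec (r (X ∪ ⁅ x ⁆) ≟ r X)) (x∈E , eq)))

  ⊆cl : ∀ {X x} → x ∈ E → x ∈ X → x ∈ cl X
  ⊆cl {X} {x} x∈E x∈X = ∈cl⁺ x∈E
    (≤-antisym (r-mono λ _ → ∪-lub (λ y → y) (⁅x⁆⊆ x∈X)) (r-mono λ _ → p⊆p∪q ⁅ x ⁆))

  r-cl : ∀ X → r (cl X) ≤ r X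
  r-cl X = ≮⇒≥ λ lt →
    let B , B⊆X , indB , _ = basis X
        D , D⊆cl , indD , _ = basis (cl X)
        e , e∈D , e∉B , ind = augment indB indD lt
        B∪e⊆X∪e = ∪-lub (p⊆p∪q ⁅ e ⁆ ∘ B⊆X) (q⊆p∪q X ⁅ e ⁆)
    in  <-irrefl refl (<-≤-trans (p⊂q⇒∣p∣<∣q∣ (∉⇒⊂ e∉B))
          (≤-trans (indep≤r B∪e⊆X∪e ind) (≤-reflexive (proj₂ (∈cl⁻ (D⊆cl e∈D))))))

  cl-idem : ∀ X → IsFlat (cl X)
  cl-idem X = ⊆-antisym to (λ x∈ → ⊆cl (proj₁ (∈cl⁻ x∈)) x∈)
    where
    to : cl (cl X) ⊆ cl X
    to {z} z∈ = let z∈E , eq = ∈cl⁻ z∈ in ∈cl⁺ z∈E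
      (≤-antisym
        (≤-trans (r-mono (λ y∈E → step y∈E ∘ x∈p∪q⁻ X ⁅ z ⁆))
                 (≤-trans (≤-reflexive eq) (r-cl X)))
        (r-mono λ _ → p⊆p∪q ⁅ z ⁆))
      where
      step : ∀ {y} → y ∈ E → y ∈ X ⊎ y ∈ ⁅ z ⁆ → y ∈ cl X ∪ ⁅ z ⁆
      step y∈E (inj₁ y∈X) = p⊆p∪q ⁅ z ⁆ (⊆cl y∈E y∈X)
      step y∈E (inj₂ y∈z) = q⊆p∪q (cl X) ⁅ z ⁆ y∈z

  closure : Subset n → Flat
  closure X = cl X , cl-idem X

open Matroid public using (Flat)

-- Only meaningful for X ⊆ E; elements of X outside E would become loops.
infixl 7 _↾_
_↾_ : Matroid n → Subset n → Matroid n
M ↾ X = record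
  { E       = X
  ; Indep   = λ I → I ⊆ X × Indep I
  ; Indep?  = λ I → (I ⊆? X) ×-dec Indep? I
  ; indep⊆E = proj₁
  ; indep-∅ = (⊥-elim ∘ ∉⊥) , indep-∅
  ; indep-↓ = λ I⊆J (J⊆X , indJ) → (J⊆X ∘ I⊆J) , indep-↓ I⊆J indJ
  ; augment = λ (I⊆X , indI) (J⊆X , indJ) I<J →
      let e , e∈J , e∉I , ind = augment indI indJ I<J
      in  e , e∈J , e∉I , ∪-lub I⊆X (⁅x⁆⊆ (J⊆X e∈J)) , ind
  }
  where open Matroid M

infixl 7 _＼_
_＼_ : Matroid n → Subset n → Matroid n
M ＼ T = M ↾ (Matroid.E M ─ T)

-- The bases of M * are the complements E ─ B of the bases B of M.
infix 8 _*
_* : Matroid n → Matroid n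
M * = record
  { E       = E
  ; Indep   = Coindep
  ; Indep?  = λ I → anySubset? λ B → IsBase? B ×-dec (I ⊆? (E ─ B))
  ; indep⊆E = λ (B , _ , I⊆) → p─q⊆p E B ∘ I⊆
  ; indep-∅ = let B , isB = basis E in B , isB , (⊥-elim ∘ ∉⊥)
  ; indep-↓ = λ I⊆J (B , isB , J⊆) → B , isB , (J⊆ ∘ I⊆J)
  ; augment = coaugment
  }
  where
  open Matroid M

  Coindep : Subset _ → Set
  Coindep I = ∃[ B ] IsBase B × I ⊆ E ─ B

  coaugment : ∀ {I J} → Coindep I → Coindep J → ∣ I ∣ < ∣ J ∣ →
              ∃[ e ] e ∈ J × e ∉ I × Coindep (I ∪ ⁅ e ⁆)
  coaugment {I} {J} (B , isB@(B⊆E , indB , maxB) , I⊆) (B′ , isB′@(B′⊆E , indB′ , _) , J⊆) I<J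
    with extend {(B′ ─ I) ∪ B} {B′ ─ I} (p⊆p∪q B) (indep-↓ (p─q⊆p B′ I) indB′)
  ... | B″ , ⊆B″ , isB″@(B″⊆ , indB″ , _) = result
    where
    isB-X : IsBasisOf ((B′ ─ I) ∪ B) B
    isB-X = q⊆p∪q (B′ ─ I) B , indB , λ _ indK → maxB (indep⊆E indK) indK

    size : ∣ B″ ∣ ≡ ∣ B′ ∣
    size = trans (basis-size isB″ isB-X) (basis-size isB isB′)

    base″ : IsBase B″
    base″ = indep⊆E indB″ , indB″ , max
      where
      max : ∀ {K} → K ⊆ E → Indep K → B″ ⊆ K → K ⊆ B″
      max {K} K⊆E indK B″⊆K {x} x∈K with x ∈? B″
      ... | yes x∈ = x∈
      ... | no  x∉ = ⊥-elim (<-irrefl refl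
        (<-≤-trans (p⊂q⇒∣p∣<∣q∣ (B″⊆K , x , x∈K , x∉))
          (≤-trans (indep≤basis isB′ K⊆E indK) (≤-reflexive (sym size)))))

    I∌B″ : ∀ {x} → x ∈ I → x ∉ B″
    I∌B″ x∈I x∈B″ with x∈p∪q⁻ (B′ ─ I) B (B″⊆ x∈B″)
    ... | inj₁ x∈ = proj₂ (x∈p─q⁻ B′ I x∈) x∈I
    ... | inj₂ x∈ = proj₂ (x∈p─q⁻ E B (I⊆ x∈I)) x∈

    I⊆E─B″ : I ⊆ E ─ B″
    I⊆E─B″ x∈I = x∈p∧x∉q⇒x∈p─q (p─q⊆p E B (I⊆ x∈I)) (I∌B″ x∈I)

    B′∌J : ∀ {x} → x ∈ B′ → x ∉ J
    B′∌J x∈B′ x∈J = proj₂ (x∈p─q⁻ E B′ (J⊆ x∈J)) x∈B′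

    I─J<J─I : ∣ I ─ J ∣ < ∣ J ─ I ∣
    I─J<J─I = +-cancelˡ-< ∣ I ∩ J ∣ _ _ (begin-strict
      ∣ I ∩ J ∣ + ∣ I ─ J ∣ ≡⟨ ∣p∣≡∣p∩q∣+∣p─q∣ I J ⟨
      ∣ I ∣                 <⟨ I<J ⟩
      ∣ J ∣                 ≡⟨ ∣p∣≡∣p∩q∣+∣p─q∣ J I ⟩
      ∣ J ∩ I ∣ + ∣ J ─ I ∣ ≡⟨ cong (λ K → ∣ K ∣ + ∣ J ─ I ∣) (∩-comm J I) ⟩
      ∣ I ∩ J ∣ + ∣ J ─ I ∣ ∎)
      where open ≤-Reasoning

    absurd : J ─ I ⊆ B″ → ∣ B′ ∣ < ∣ B″ ∣
    absurd J─I⊆B″ = begin-strict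
      ∣ B′ ∣                   ≡⟨ ∣p∣≡∣p∩q∣+∣p─q∣ B′ I ⟩
      ∣ B′ ∩ I ∣ + ∣ B′ ─ I ∣  ≤⟨ +-mono-≤ (p⊆q⇒∣p∣≤∣q∣ left) ≤-refl ⟩
      ∣ I ─ J ∣ + ∣ B′ ─ I ∣   <⟨ +-monoˡ-< ∣ B′ ─ I ∣ I─J<J─I ⟩
      ∣ J ─ I ∣ + ∣ B′ ─ I ∣   ≤⟨ +-mono-≤ (p⊆q⇒∣p∣≤∣q∣ mid) (p⊆q⇒∣p∣≤∣q∣ right) ⟩
      ∣ B″ ∩ J ∣ + ∣ B″ ─ J ∣  ≡⟨ ∣p∣≡∣p∩q∣+∣p─q∣ B″ J ⟨
      ∣ B″ ∣                   ∎
      where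
      open ≤-Reasoning
      left : B′ ∩ I ⊆ I ─ J
      left x∈ = let x∈B′ , x∈I = x∈p∩q⁻ B′ I x∈ in x∈p∧x∉q⇒x∈p─q x∈I (B′∌J x∈B′)
      mid : J ─ I ⊆ B″ ∩ J
      mid x∈ = x∈p∩q⁺ (J─I⊆B″ x∈ , p─q⊆p J I x∈)
      right : B′ ─ I ⊆ B″ ─ J
      right x∈ = x∈p∧x∉q⇒x∈p─q (⊆B″ x∈) (B′∌J (p─q⊆p B′ I x∈))

    result : ∃[ e ] e ∈ J × e ∉ I × Coindep (I ∪ ⁅ e ⁆)
    result with any? (λ e → (e ∈? J) ×-dec (¬? (e ∈? I) ×-dec ¬? (e ∈? B″)))
    ... | yes (e , e∈J , e∉I , e∉B″) = e , e∈J , e∉I , B″ , base″ ,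
      ∪-lub I⊆E─B″ (⁅x⁆⊆ (x∈p∧x∉q⇒x∈p─q (p─q⊆p E B′ (J⊆ e∈J)) e∉B″))
    ... | no none = ⊥-elim (<-irrefl (sym size) (absurd J─I⊆B″))
      where
      J─I⊆B″ : J ─ I ⊆ B″
      J─I⊆B″ {x} x∈ with x ∈? B″
      ... | yes x∈B″ = x∈B″
      ... | no  x∉B″ = let x∈J , x∉I = x∈p─q⁻ J I x∈ in ⊥-elim (none (x , x∈J , x∉I , x∉B″))

infixl 7 _/_
_/_ : Matroid n → Subset n → Matroid n
M / C = (M * ＼ C) *

record IsAdjointMap {m n} (M : Matroid m) (M′ : Matroid n) (φ : Flat M → Flat M′) : Set where
  private
    module M  = Matroid M
    module M′ = Matroid M′
  field
    simple           : M′.Simple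
    same-rank        : M′.rank ≡ M.rank
    injective        : Injective _≡_ _≡_ φ
    antitone         : ∀ {F₁ F₂} → M.set F₁ ⊆ M.set F₂ → M′.set (φ F₂) ⊆ M′.set (φ F₁)
    hyperplane⇒point : ∀ {H} → M.IsHyperplane H → M′.IsPoint (φ H)

  restricted : ∃ M.IsHyperplane → ∃ M′.IsPoint
  restricted (H , h) = φ H , hyperplane⇒point h

  field
    bijective : Bijective _≡_ _≡_ restricted

{-# OPTIONS --safe #-}

-- Since φ is injective and reverses inclusion, it turns a chain of flats that
-- rises one rank at a time into a strictly descending chain, so that
-- r(F) + r′(φ F) = r(M) for every flat F.  With r(M/C) = r(M) − r(C) and the
-- description of the flats of M/C, everything but the surjectivity onto the
-- points of M′|φ(cl C) follows.  Such a point is φ H for a hyperplane H of M, and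
-- it remains to see that φ H ⊆ φ F forces F ⊆ H, which is shown by enlarging
-- flats inside H.

module Submission where

open import Defs
open import Axiom.UniquenessOfIdentityProofs using (module Decidable⇒UIP)
open import Data.Bool.Properties using () renaming (_≟_ to _≟ᵇ_)
open import Data.Empty using (⊥-elim)
open import Data.Fin using (Fin)
open import Data.Fin.Properties using (any?)
open import Data.Fin.Subset using (Subset; ⊥; ⁅_⁆; _∈_; _∉_; _⊆_; _⊈_; _∪_; _∩_; _─_; ∣_∣)
open import Data.Fin.Subset.Properties
open import Data.Nat using (ℕ; zero; suc; _+_; _∸_; _≤_; _<_; s≤s)
import Data.Nat.Properties as ℕ
open import Algebra.Properties.CommutativeSemigroup ℕ.+-commutativeSemigroup
  using (x∙yz≈y∙xz; x∙yz≈yx∙z; xy∙z≈y∙xz)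
open import Data.Product using (Σ-syntax; ∃; ∃-syntax; _×_; _,_; proj₁; proj₂)
open import Data.Sum using (inj₁; inj₂; [_,_]′)
open import Data.Vec.Properties using (≡-dec)
open import Function using (_∘_; id)
open import Function.Definitions using (Bijective)
open import Relation.Binary.PropositionalEquality
  using (_≡_; refl; sym; trans; cong; subst; module ≡-Reasoning)
open import Relation.Nullary using (¬_; yes; no)
open import Relation.Nullary.Decidable using (_×-dec_; ¬?; decidable-stable)

private
  variable
    m n : ℕ

-- Finite subsets.

⊈⇒∃∉ : {p q : Subset n} → p ⊈ q → ∃[ x ] x ∈ p × x ∉ q
⊈⇒∃∉ {p = p} {q} p⊈q with any? (λ x → (x ∈? p) ×-dec ¬? (x ∈? q))
... | yes found = found
... | no  none  = ⊥-elim (p⊈q λ {x} x∈p →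
  decidable-stable (x ∈? q) λ x∉q → none (x , x∈p , x∉q))

∪-mono-⊆ : {p p′ q q′ : Subset n} → p ⊆ p′ → q ⊆ q′ → p ∪ q ⊆ p′ ∪ q′
∪-mono-⊆ {p′ = p′} {q′ = q′} p⊆p′ q⊆q′ =
  ∪-lub (p⊆p∪q q′ ∘ p⊆p′) (q⊆p∪q p′ q′ ∘ q⊆q′)

─-∪-⊇ : (p q : Subset n) → p ⊆ (p ─ q) ∪ q
─-∪-⊇ p q {x} x∈p with x ∈? q
... | yes x∈q = q⊆p∪q (p ─ q) q x∈q
... | no  x∉q = p⊆p∪q q (x∈p∧x∉q⇒x∈p─q x∈p x∉q)

─-∪-cancel : {p q : Subset n} → q ⊆ p → (p ─ q) ∪ q ≡ p
─-∪-cancel {p = p} {q} q⊆p = ⊆-antisym (∪-lub (p─q⊆p p q) q⊆p) (─-∪-⊇ p q)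

∣q∣+∣p─q∣≡∣p∣ : {p q : Subset n} → q ⊆ p → ∣ q ∣ + ∣ p ─ q ∣ ≡ ∣ p ∣
∣q∣+∣p─q∣≡∣p∣ {p = p} {q} q⊆p = sym (trans (∣p∣≡∣p∩q∣+∣p─q∣ p q)
  (cong (λ s → ∣ s ∣ + ∣ p ─ q ∣) (⊆-antisym (p∩q⊆q p q) (λ x∈q → x∈p∩q⁺ (q⊆p x∈q , x∈q)))))

-- Rank, closure and flats of a matroid.

module Rank (M : Matroid n) where
  open Matroid M public hiding (Flat)

  -- Flatness is an equation between Boolean vectors, whose equality is decidable, so it has at most
  -- one proof.
  flat-≡ : {F G : Flat M} → set F ≡ set G → F ≡ G
  flat-≡ {_ , p} {_ , q} refl = cong (_ ,_) (≡-irrelevant p q)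
    where open Decidable⇒UIP (≡-dec _≟ᵇ_)

  flat⊆E : (F : Flat M) → set F ⊆ E
  flat⊆E (F , isF) x∈F = proj₁ (∈cl⁻ (subst (_ ∈_) (sym isF) x∈F))

  ⊆⇒flat : ∀ {F} → F ⊆ E → cl F ⊆ F → IsFlat F
  ⊆⇒flat F⊆E cl⊆ = ⊆-antisym cl⊆ (λ x∈F → ⊆cl (F⊆E x∈F) x∈F)

  r-mono-⊆ : ∀ {X Y} → X ⊆ Y → r X ≤ r Y
  r-mono-⊆ X⊆Y = r-mono λ _ → X⊆Y

  r-<⇒∃∉ : ∀ {X Y} → r X < r Y → ∃[ x ] x ∈ Y × x ∉ X
  r-<⇒∃∉ rX<rY = ⊈⇒∃∉ (ℕ.<⇒≱ rX<rY ∘ r-mono-⊆)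

  r-basis : ∀ {X B} → IsBasisOf X B → r X ≡ ∣ B ∣
  r-basis {X} isB = basis-size (proj₂ (basis X)) isB

  r-⊥ : r ⊥ ≡ 0
  r-⊥ = ℕ.n≤0⇒n≡0 (subst (r ⊥ ≤_) (∣⊥∣≡0 n) (let _ , B⊆⊥ , _ = basis ⊥ in p⊆q⇒∣p∣≤∣q∣ B⊆⊥))

  r-closure : ∀ X → r (cl X) ≡ r X
  r-closure X = ℕ.≤-antisym (r-cl X) (r-mono λ x∈E x∈X → ⊆cl x∈E x∈X)

  -- A basis of `X ∪ ⁅ x ⁆` loses at most one element when `x` is removed, and what remains is
  -- independent inside `X`.
  r-∪⁅⁆-≤ : ∀ X x → r (X ∪ ⁅ x ⁆) ≤ suc (r X)
  r-∪⁅⁆-≤ X x = let B , B⊆ , indB , _ = basis (X ∪ ⁅ x ⁆) in begin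
    ∣ B ∣                          ≡⟨ ∣p∣≡∣p∩q∣+∣p─q∣ B ⁅ x ⁆ ⟩
    ∣ B ∩ ⁅ x ⁆ ∣ + ∣ B ─ ⁅ x ⁆ ∣  ≤⟨ ℕ.+-mono-≤ (p⊆q⇒∣p∣≤∣q∣ (p∩q⊆q B ⁅ x ⁆))
                                       (indep≤r (rest B⊆) (indep-↓ (p─q⊆p B ⁅ x ⁆) indB)) ⟩
    ∣ ⁅ x ⁆ ∣ + r X                ≡⟨ cong (_+ r X) (∣⁅x⁆∣≡1 x) ⟩
    suc (r X)                      ∎
    where
    open ℕ.≤-Reasoning
    rest : ∀ {B} → B ⊆ X ∪ ⁅ x ⁆ → B ─ ⁅ x ⁆ ⊆ X
    rest {B} B⊆ y∈ with x∈p─q⁻ B ⁅ x ⁆ y∈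
    ... | y∈B , y∉x = [ id , ⊥-elim ∘ y∉x ]′ (x∈p∪q⁻ X ⁅ x ⁆ (B⊆ y∈B))

  r-∪⁅⁆-∉cl : ∀ {X x} → x ∈ E → x ∉ cl X → r (X ∪ ⁅ x ⁆) ≡ suc (r X)
  r-∪⁅⁆-∉cl {X} {x} x∈E x∉ = ℕ.≤-antisym (r-∪⁅⁆-≤ X x)
    (ℕ.≤∧≢⇒< (r-mono-⊆ (p⊆p∪q ⁅ x ⁆)) (x∉ ∘ ∈cl⁺ x∈E ∘ sym))

  -- Extend a basis `B` of `X` to a basis `B′` of `Y`. If `x` raised the rank of `Y`, some element
  -- would augment `B′`; by maximality of `B′` in `Y` it can only be `x`. Then `B ∪ ⁅ x ⁆` is
  -- independent, so `x` raises the rank of `X` as well.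
  cl-mono : ∀ {X Y} → X ⊆ Y → cl X ⊆ cl Y
  cl-mono {X} {Y} X⊆Y {x} x∈ with ∈cl⁻ x∈ | basis X
  ... | x∈E , eq | B , isB@(B⊆X , indB , _) with extend (X⊆Y ∘ B⊆X) indB
  ... | B′ , B⊆B′ , isB′@(B′⊆Y , indB′ , max′) =
    ∈cl⁺ x∈E (ℕ.≤-antisym (ℕ.≮⇒≥ bigger) (r-mono-⊆ (p⊆p∪q ⁅ x ⁆)))
    where
    bigger : ¬ r Y < r (Y ∪ ⁅ x ⁆)
    bigger lt with basis (Y ∪ ⁅ x ⁆)
    ... | D , D⊆ , indD , _
      with augment indB′ indD (subst (_< ∣ D ∣) (r-basis isB′) lt)
    ... | e , e∈D , e∉B′ , ind with x∈p∪q⁻ Y ⁅ x ⁆ (D⊆ e∈D)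
    ... | inj₁ e∈Y = e∉B′ (max′ (∪-lub B′⊆Y (⁅x⁆⊆ e∈Y)) ind (p⊆p∪q ⁅ e ⁆)
                             (q⊆p∪q B′ ⁅ e ⁆ (x∈⁅x⁆ e)))
    ... | inj₂ e∈x with x∈⁅y⁆⇒x≡y x e∈x
    ... | refl = ℕ.<-irrefl refl (begin-strict
      ∣ B ∣           <⟨ p⊂q⇒∣p∣<∣q∣ (∉⇒⊂ (e∉B′ ∘ B⊆B′)) ⟩
      ∣ B ∪ ⁅ x ⁆ ∣   ≤⟨ indep≤r (∪-mono-⊆ B⊆X id) (indep-↓ (∪-mono-⊆ B⊆B′ id) ind) ⟩
      r (X ∪ ⁅ x ⁆)   ≡⟨ eq ⟩
      r X             ≡⟨ r-basis isB ⟩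
      ∣ B ∣           ∎)
      where open ℕ.≤-Reasoning

  cl⊆flat : ∀ {X} (F : Flat M) → X ⊆ set F → cl X ⊆ set F
  cl⊆flat (F , isF) X⊆F x∈ = subst (_ ∈_) isF (cl-mono X⊆F x∈)

  ⊆cl-rank : ∀ {X Y} → X ⊆ Y → Y ⊆ E → r Y ≤ r X → Y ⊆ cl X
  ⊆cl-rank {X} {Y} X⊆Y Y⊆E rY≤rX {x} x∈Y = ∈cl⁺ (Y⊆E x∈Y)
    (ℕ.≤-antisym (ℕ.≤-trans (r-mono-⊆ (∪-lub X⊆Y (⁅x⁆⊆ x∈Y))) rY≤rX)
                 (r-mono-⊆ (p⊆p∪q ⁅ x ⁆)))

  -- With no more rank than `F`, the larger flat lies in the closure of `F`, which is `F`. Flats are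
  -- identified by rank through this lemma.
  flat-⊆-rank : (F G : Flat M) → set F ⊆ set G → r (set G) ≤ r (set F) → F ≡ G
  flat-⊆-rank F G F⊆G rG≤rF = flat-≡ {F} {G} (⊆-antisym F⊆G
    (cl⊆flat F id ∘ ⊆cl-rank F⊆G (flat⊆E G) rG≤rF))

  -- For `x` in `E` outside `F` this is the flat covering `F` that contains `x`; chains of flats are
  -- built from such steps.
  infixl 6 _⊕_
  _⊕_ : Flat M → Fin n → Flat M
  F ⊕ x = closure (set F ∪ ⁅ x ⁆)

  ⊆⊕ : (F : Flat M) (x : Fin n) → set F ⊆ set (F ⊕ x)
  ⊆⊕ F x y∈F = ⊆cl (flat⊆E F y∈F) (p⊆p∪q ⁅ x ⁆ y∈F)

  ∈⊕ : ∀ (F : Flat M) {x} → x ∈ E → x ∈ set (F ⊕ x)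
  ∈⊕ F {x} x∈E = ⊆cl x∈E (q⊆p∪q (set F) ⁅ x ⁆ (x∈⁅x⁆ x))

  ⊕⊆ : ∀ (F G : Flat M) {x} → set F ⊆ set G → x ∈ set G → set (F ⊕ x) ⊆ set G
  ⊕⊆ F G F⊆G x∈G = cl⊆flat G (∪-lub F⊆G (⁅x⁆⊆ x∈G))

  r-⊕ : ∀ (F : Flat M) {x} → x ∈ E → x ∉ set F → r (set (F ⊕ x)) ≡ suc (r (set F))
  r-⊕ F x∈E x∉F = trans (r-closure _) (r-∪⁅⁆-∉cl x∈E (x∉F ∘ cl⊆flat F id))

  -- Both flats equal cl (A ∪ x) for any x ∈ B outside A.
  flats-agree : ∀ (A P Q : Flat M) {B} → B ⊈ set A →
    set A ⊆ set P → B ⊆ set P → set A ⊆ set Q → B ⊆ set Q →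
    r (set P) ≡ suc (r (set A)) → r (set Q) ≡ suc (r (set A)) → P ≡ Q
  flats-agree A P Q B⊈A A⊆P B⊆P A⊆Q B⊆Q rP rQ with ⊈⇒∃∉ B⊈A
  ... | x , x∈B , x∉A = trans (sym (same P A⊆P (B⊆P x∈B) rP)) (same Q A⊆Q (B⊆Q x∈B) rQ)
    where
    same : ∀ G → set A ⊆ set G → x ∈ set G → r (set G) ≡ suc (r (set A)) → A ⊕ x ≡ G
    same G A⊆G x∈G rG = flat-⊆-rank (A ⊕ x) G (⊕⊆ A G A⊆G x∈G)
      (ℕ.≤-reflexive (trans rG (sym (r-⊕ A (flat⊆E G x∈G) x∉A))))

-- Rank, flats and simplicity of a restriction.

module Restriction (M : Matroid n) (X : Subset n) where
  private
    module M = Rank M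
    module N = Rank (M ↾ X)

  r-↾ : ∀ {Y} → Y ⊆ X → N.r Y ≡ M.r Y
  r-↾ {Y} Y⊆X = ℕ.≤-antisym
    (let B , B⊆Y , (_ , indB) , _ = N.basis Y in M.indep≤r B⊆Y indB)
    (let B , B⊆Y , indB , _ = M.basis Y in N.indep≤r B⊆Y (Y⊆X ∘ B⊆Y , indB))

  flat-↾⁺ : (F : Flat M) → X ⊆ M.E → M.set F ⊆ X → N.IsFlat (M.set F)
  flat-↾⁺ F X⊆E F⊆X = N.⊆⇒flat F⊆X λ x∈ → let x∈X , eq = N.∈cl⁻ x∈ in
    M.cl⊆flat F id (M.∈cl⁺ (X⊆E x∈X)
      (trans (sym (r-↾ (∪-lub F⊆X (⁅x⁆⊆ x∈X)))) (trans eq (r-↾ F⊆X))))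

  -- Since `X` is a flat, the closure of `P` in `M` stays inside `X`, where the two rank functions
  -- agree.
  flat-↾⁻ : M.IsFlat X → (P : Flat (M ↾ X)) → M.IsFlat (N.set P)
  flat-↾⁻ isX P = M.⊆⇒flat (M.flat⊆E (X , isX) ∘ P⊆X) λ x∈ →
    let x∈X = M.cl⊆flat (X , isX) P⊆X x∈ in
    N.cl⊆flat P id (N.∈cl⁺ x∈X
      (trans (r-↾ (∪-lub P⊆X (⁅x⁆⊆ x∈X))) (trans (proj₂ (M.∈cl⁻ x∈)) (sym (r-↾ P⊆X)))))
    where P⊆X = N.flat⊆E P

  -- Circuits of the restriction are circuits of `M`, so a loop or a parallel pair would carry over
  -- to `M`.
  simple-↾ : X ⊆ M.E → M.Simple → N.Simple
  simple-↾ X⊆E (noLoop , noParallel) =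
    (λ e → noLoop e ∘ circuit) , (λ e f (e≢f , c) → noParallel e f (e≢f , circuit c))
    where
    circuit : ∀ {D} → N.IsCircuit D → M.IsCircuit D
    circuit (D⊆X , dep , minimal) =
      X⊆E ∘ D⊆X , (λ ind → dep (D⊆X , ind)) , (λ D⊂ → proj₂ (minimal D⊂))

-- The rank function of the dual.

module Dual (M : Matroid n) where
  private
    module M = Rank M
    module D = Rank (M *)

  -- The usual formula for the dual rank has `M.rank` subtracted on the right; it is kept additive
  -- because subtraction of naturals truncates.
  r-* : ∀ {X} → X ⊆ M.E → D.r X + M.rank ≡ ∣ X ∣ + M.r (M.E ─ X)
  r-* {X} X⊆E = ℕ.≤-antisym upper lower
    where
    open ℕ.≤-Reasoning

    upper : D.r X + M.rank ≤ ∣ X ∣ + M.r (M.E ─ X)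
    -- The coindependent set `I` avoids a base `B`, so it lies in `X ─ B`, while `B ─ X` is
    -- independent in `M.E ─ X`.
    upper = let I , I⊆X , (B , isB@(B⊆E , indB , _) , I⊆) , _ = D.basis X in begin
      D.r X + M.rank                        ≡⟨ cong (∣ I ∣ +_) (M.r-basis isB) ⟩
      ∣ I ∣ + ∣ B ∣                         ≤⟨ ℕ.+-monoˡ-≤ ∣ B ∣ (p⊆q⇒∣p∣≤∣q∣ λ x∈I →
                                                x∈p∧x∉q⇒x∈p─q (I⊆X x∈I) (proj₂ (x∈p─q⁻ M.E B (I⊆ x∈I)))) ⟩
      ∣ X ─ B ∣ + ∣ B ∣                     ≡⟨ cong (∣ X ─ B ∣ +_) (∣p∣≡∣p∩q∣+∣p─q∣ B X) ⟩
      ∣ X ─ B ∣ + (∣ B ∩ X ∣ + ∣ B ─ X ∣)   ≡⟨ x∙yz≈yx∙z ∣ X ─ B ∣ ∣ B ∩ X ∣ _ ⟩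
      ∣ B ∩ X ∣ + ∣ X ─ B ∣ + ∣ B ─ X ∣     ≡⟨ cong (λ S → ∣ S ∣ + ∣ X ─ B ∣ + ∣ B ─ X ∣) (∩-comm B X) ⟩
      ∣ X ∩ B ∣ + ∣ X ─ B ∣ + ∣ B ─ X ∣     ≡⟨ cong (_+ ∣ B ─ X ∣) (∣p∣≡∣p∩q∣+∣p─q∣ X B) ⟨
      ∣ X ∣ + ∣ B ─ X ∣                     ≤⟨ ℕ.+-monoʳ-≤ ∣ X ∣ (M.indep≤r
                                                (λ x∈ → let x∈B , x∉X = x∈p─q⁻ B X x∈ in x∈p∧x∉q⇒x∈p─q (B⊆E x∈B) x∉X)
                                                (M.indep-↓ (p─q⊆p B X) indB)) ⟩
      ∣ X ∣ + M.r (M.E ─ X)                 ∎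

    lower : ∣ X ∣ + M.r (M.E ─ X) ≤ D.r X + M.rank
    -- With a basis `A` of `M.E ─ X` extended to a base `B`, the set `X ─ B` is coindependent and
    -- `A` lies in `B ─ X`.
    lower = let A , A⊆ , indA , _ = M.basis (M.E ─ X)
                B , A⊆B , isB = M.extend (M.indep⊆E indA) indA in begin
      ∣ X ∣ + M.r (M.E ─ X)                 ≡⟨ cong (_+ ∣ A ∣) (∣p∣≡∣p∩q∣+∣p─q∣ X B) ⟩
      ∣ X ∩ B ∣ + ∣ X ─ B ∣ + ∣ A ∣         ≤⟨ ℕ.+-monoʳ-≤ (∣ X ∩ B ∣ + ∣ X ─ B ∣) (p⊆q⇒∣p∣≤∣q∣ λ x∈A →
                                                x∈p∧x∉q⇒x∈p─q (A⊆B x∈A) (proj₂ (x∈p─q⁻ M.E X (A⊆ x∈A)))) ⟩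
      ∣ X ∩ B ∣ + ∣ X ─ B ∣ + ∣ B ─ X ∣     ≡⟨ x∙yz≈yx∙z ∣ X ─ B ∣ ∣ X ∩ B ∣ _ ⟨
      ∣ X ─ B ∣ + (∣ X ∩ B ∣ + ∣ B ─ X ∣)   ≡⟨ cong (λ S → ∣ X ─ B ∣ + (∣ S ∣ + ∣ B ─ X ∣)) (∩-comm X B) ⟩
      ∣ X ─ B ∣ + (∣ B ∩ X ∣ + ∣ B ─ X ∣)   ≡⟨ cong (∣ X ─ B ∣ +_) (∣p∣≡∣p∩q∣+∣p─q∣ B X) ⟨
      ∣ X ─ B ∣ + ∣ B ∣                     ≤⟨ ℕ.+-monoˡ-≤ ∣ B ∣ (D.indep≤r (p─q⊆p X B)
                                                (B , isB , λ x∈ → let x∈X , x∉B = x∈p─q⁻ X B x∈ in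
                                                           x∈p∧x∉q⇒x∈p─q (X⊆E x∈X) x∉B)) ⟩
      D.r X + ∣ B ∣                         ≡⟨ cong (D.r X +_) (M.r-basis isB) ⟨
      D.r X + M.rank                        ∎

-- Rank and flats of a contraction.

module Contraction (M : Matroid n) {C : Subset n} (C⊆E : C ⊆ Matroid.E M) where
  private
    module M = Rank M
    module D = Rank (M *)
    module N = Rank (M * ＼ C)
    module K = Rank (M / C)

  -- The dual rank formula is used three times: for `M * ＼ C` at `Y`, and for `M` at `E─C` and at
  -- `E─C ─ Y`, whose complements in `M.E` are `C` and `Y ∪ C`. The cardinalities then cancel.
  r-/ : ∀ {Y} → Y ⊆ M.E ─ C → K.r Y + M.r C ≡ M.r (Y ∪ C)
  r-/ {Y} Y⊆ = ℕ.+-cancelˡ-≡ ∣ E─C ∣ _ _ (ℕ.+-cancelˡ-≡ M.rank _ _ (begin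
    M.rank + (∣ E─C ∣ + (K.r Y + M.r C))            ≡⟨ cong (M.rank +_) (x∙yz≈y∙xz ∣ E─C ∣ (K.r Y) _) ⟩
    M.rank + (K.r Y + (∣ E─C ∣ + M.r C))            ≡⟨ cong (λ z → M.rank + (K.r Y + z)) dual-E─C ⟨
    M.rank + (K.r Y + (D.r E─C + M.rank))           ≡⟨ cong (M.rank +_) (ℕ.+-assoc (K.r Y) _ _) ⟨
    M.rank + (K.r Y + D.r E─C + M.rank)             ≡⟨ cong (λ z → M.rank + (z + M.rank)) (trans (cong (K.r Y +_) (sym (r-↾ id))) (Dual.r-* (M * ＼ C) Y⊆)) ⟩
    M.rank + (∣ Y ∣ + N.r (E─C ─ Y) + M.rank)       ≡⟨ cong (λ z → M.rank + (∣ Y ∣ + z + M.rank)) (r-↾ (p─q⊆p E─C Y)) ⟩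
    M.rank + (∣ Y ∣ + D.r (E─C ─ Y) + M.rank)       ≡⟨ cong (M.rank +_) (ℕ.+-assoc ∣ Y ∣ _ _) ⟩
    M.rank + (∣ Y ∣ + (D.r (E─C ─ Y) + M.rank))     ≡⟨ cong (λ z → M.rank + (∣ Y ∣ + z)) dual-E─C─Y ⟩
    M.rank + (∣ Y ∣ + (∣ E─C ─ Y ∣ + M.r (Y ∪ C)))  ≡⟨ cong (M.rank +_) (ℕ.+-assoc ∣ Y ∣ _ _) ⟨
    M.rank + (∣ Y ∣ + ∣ E─C ─ Y ∣ + M.r (Y ∪ C))    ≡⟨ cong (λ z → M.rank + (z + M.r (Y ∪ C))) (∣q∣+∣p─q∣≡∣p∣ Y⊆) ⟩
    M.rank + (∣ E─C ∣ + M.r (Y ∪ C))                ∎))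
    where
    open ≡-Reasoning
    open Restriction (M *) (M.E ─ C)
    E─C = M.E ─ C

    dual-E─C : D.r E─C + M.rank ≡ ∣ E─C ∣ + M.r C
    dual-E─C = trans (Dual.r-* M (p─q⊆p M.E C)) (cong (λ z → ∣ E─C ∣ + M.r z)
      (⊆-antisym
        (λ {x} x∈ → let x∈E , x∉ = x∈p─q⁻ M.E E─C x∈ in
          [ ⊥-elim ∘ x∉ , id ]′ (x∈p∪q⁻ E─C C (─-∪-⊇ M.E C x∈E)))
        (λ x∈C → x∈p∧x∉q⇒x∈p─q (C⊆E x∈C) λ x∈ → proj₂ (x∈p─q⁻ M.E C x∈) x∈C)))

    dual-E─C─Y : D.r (E─C ─ Y) + M.rank ≡ ∣ E─C ─ Y ∣ + M.r (Y ∪ C)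
    dual-E─C─Y = trans (Dual.r-* M (p─q⊆p M.E C ∘ p─q⊆p E─C Y)) (cong (λ z → ∣ E─C ─ Y ∣ + M.r z)
      (⊆-antisym to (∪-lub
        (λ x∈Y → x∈p∧x∉q⇒x∈p─q (p─q⊆p M.E C (Y⊆ x∈Y)) λ x∈ → proj₂ (x∈p─q⁻ E─C Y x∈) x∈Y)
        (λ x∈C → x∈p∧x∉q⇒x∈p─q (C⊆E x∈C) λ x∈ → proj₂ (x∈p─q⁻ M.E C (p─q⊆p E─C Y x∈)) x∈C))))
      where
      to : M.E ─ (E─C ─ Y) ⊆ Y ∪ C
      to x∈ with x∈p─q⁻ M.E (E─C ─ Y) x∈
      ... | x∈E , x∉ with x∈p∪q⁻ E─C C (─-∪-⊇ M.E C x∈E)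
      ... | inj₂ x∈C = q⊆p∪q Y C x∈C
      ... | inj₁ x∈E─C with x∈p∪q⁻ (E─C ─ Y) Y (─-∪-⊇ E─C Y x∈E─C)
      ... | inj₁ x∈′ = ⊥-elim (x∉ x∈′)
      ... | inj₂ x∈Y = p⊆p∪q C x∈Y

  rank-/ : K.rank + M.r C ≡ M.rank
  rank-/ = trans (r-/ id) (cong M.r (─-∪-cancel C⊆E))

  ∪-∪⁅⁆ : ∀ Y x → (Y ∪ ⁅ x ⁆) ∪ C ≡ (Y ∪ C) ∪ ⁅ x ⁆
  ∪-∪⁅⁆ Y x = trans (∪-assoc Y ⁅ x ⁆ C)
    (trans (cong (Y ∪_) (∪-comm ⁅ x ⁆ C)) (sym (∪-assoc Y C ⁅ x ⁆)))

  -- By `r-/`, passing from `M / C` to `M` adds `M.r C` to the ranks both before and after an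
  -- element `x` outside `C` is adjoined. So `x` adds no rank to `K.set F ∪ C` exactly when it adds
  -- none to `K.set F`.
  flat-/⁺ : (F : Flat (M / C)) → M.IsFlat (K.set F ∪ C)
  flat-/⁺ F = M.⊆⇒flat (∪-lub (p─q⊆p M.E C ∘ F⊆) C⊆E) closed
    where
    F⊆ = K.flat⊆E F
    closed : M.cl (K.set F ∪ C) ⊆ K.set F ∪ C
    closed {x} x∈ with x ∈? C | M.∈cl⁻ x∈
    ... | yes x∈C | _ = q⊆p∪q (K.set F) C x∈C
    ... | no  x∉C | x∈E , eq = p⊆p∪q C (K.cl⊆flat F id (K.∈cl⁺ x∈E─C
      (ℕ.+-cancelʳ-≡ (M.r C) _ _
        (trans (r-/ (∪-lub F⊆ (⁅x⁆⊆ x∈E─C)))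
        (trans (cong M.r (∪-∪⁅⁆ (K.set F) x)) (trans eq (sym (r-/ F⊆))))))))
      where x∈E─C = x∈p∧x∉q⇒x∈p─q x∈E x∉C

  flat-/⁻ : (F : Flat M) → C ⊆ M.set F → K.IsFlat (M.set F ─ C)
  flat-/⁻ F C⊆F = K.⊆⇒flat ⊆E─C closed
    where
    S = M.set F
    ⊆E─C : S ─ C ⊆ M.E ─ C
    ⊆E─C x∈ = let x∈F , x∉C = x∈p─q⁻ S C x∈ in x∈p∧x∉q⇒x∈p─q (M.flat⊆E F x∈F) x∉C
    closed : K.cl (S ─ C) ⊆ S ─ C
    closed {x} x∈ with K.∈cl⁻ x∈
    ... | x∈E─C , eq = let x∈E , x∉C = x∈p─q⁻ M.E C x∈E─C in
      x∈p∧x∉q⇒x∈p─q (M.cl⊆flat F id (M.∈cl⁺ x∈E (begin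
        M.r (S ∪ ⁅ x ⁆)              ≡⟨ cong (λ Z → M.r (Z ∪ ⁅ x ⁆)) (─-∪-cancel C⊆F) ⟨
        M.r (((S ─ C) ∪ C) ∪ ⁅ x ⁆)     ≡⟨ cong M.r (∪-∪⁅⁆ (S ─ C) x) ⟨
        M.r (((S ─ C) ∪ ⁅ x ⁆) ∪ C)     ≡⟨ r-/ (∪-lub ⊆E─C (⁅x⁆⊆ x∈E─C)) ⟨
        K.r ((S ─ C) ∪ ⁅ x ⁆) + M.r C  ≡⟨ cong (_+ M.r C) eq ⟩
        K.r (S ─ C) + M.r C          ≡⟨ r-/ ⊆E─C ⟩
        M.r ((S ─ C) ∪ C)            ≡⟨ cong M.r (─-∪-cancel C⊆F) ⟩
        M.r S                        ∎))) x∉C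
      where open ≡-Reasoning

  infixl 6 _∪C
  _∪C : Flat (M / C) → Flat M
  F ∪C = K.set F ∪ C , flat-/⁺ F

  -- Flats of the contraction avoid `C`, so they can be recovered from their unions with `C`.
  ∪C-⊆ : ∀ F G → M.set (F ∪C) ⊆ M.set (G ∪C) → K.set F ⊆ K.set G
  ∪C-⊆ F G F∪C⊆G∪C x∈F with x∈p∪q⁻ (K.set G) C (F∪C⊆G∪C (p⊆p∪q C x∈F))
  ... | inj₁ x∈G = x∈G
  ... | inj₂ x∈C = ⊥-elim (proj₂ (x∈p─q⁻ M.E C (K.flat⊆E F x∈F)) x∈C)

  ∪C-injective : ∀ {F G} → F ∪C ≡ G ∪C → F ≡ G
  ∪C-injective {F} {G} eq = K.flat-≡ {F} {G} (⊆-antisym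
    (∪C-⊆ F G (⊆-reflexive (cong M.set eq)))
    (∪C-⊆ G F (⊆-reflexive (cong M.set (sym eq)))))

  r-∪C : ∀ F → K.r (K.set F) + M.r C ≡ M.r (M.set (F ∪C))
  r-∪C F = r-/ (K.flat⊆E F)

  hyperplane-∪C⁺ : ∀ {H} → K.IsHyperplane H → M.IsHyperplane (H ∪C)
  hyperplane-∪C⁺ {H} h = trans (cong suc (sym (r-∪C H))) (trans (cong (_+ M.r C) h) rank-/)

  hyperplane-∪C⁻ : ∀ {H} → M.IsHyperplane (H ∪C) → K.IsHyperplane H
  hyperplane-∪C⁻ {H} h = ℕ.+-cancelʳ-≡ (M.r C) _ _
    (trans (cong suc (r-∪C H)) (trans h (sym rank-/)))

-- Ranks under an adjoint map.

module Adjoint {M : Matroid m} {M′ : Matroid n} {φ : Flat M → Flat M′}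
               (adj : IsAdjointMap M M′ φ) where
  private
    module M  = Rank M
    module M′ = Rank M′
  open IsAdjointMap adj public

  -- Otherwise the nested flats `φ G` and `φ F` would have equal rank and coincide, and injectivity
  -- would give `F ≡ G`.
  r-φ-< : (F G : Flat M) → M.set F ⊆ M.set G → M.r (M.set F) < M.r (M.set G) →
          M′.r (M′.set (φ G)) < M′.r (M′.set (φ F))
  r-φ-< F G F⊆G rF<rG = ℕ.≰⇒> λ rφF≤rφG →
    ℕ.<-irrefl (cong (M.r ∘ M.set)
      (sym (injective (M′.flat-⊆-rank (φ G) (φ F) (antitone {F} {G} F⊆G) rφF≤rφG)))) rF<rG

  -- Climb from `F` to `G` one rank at a time, adjoining an element of `G` at each step; by `r-φ-<`
  -- every step lowers the rank of the image by at least one.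
  r-φ-gap : ∀ k (F G : Flat M) → M.set F ⊆ M.set G → k + M.r (M.set F) ≡ M.r (M.set G) →
            k + M′.r (M′.set (φ G)) ≤ M′.r (M′.set (φ F))
  r-φ-gap zero    F G F⊆G _  = M′.r-mono-⊆ (antitone {F} {G} F⊆G)
  r-φ-gap (suc k) F G F⊆G eq with M.r-<⇒∃∉ (subst (M.r (M.set F) <_) eq (s≤s (ℕ.m≤n+m _ k)))
  ... | x , x∈G , x∉F = ℕ.≤-<-trans
    (r-φ-gap k (F M.⊕ x) G (M.⊕⊆ F G F⊆G x∈G)
      (trans (cong (k +_) rFx) (trans (ℕ.+-suc k _) eq)))
    (r-φ-< F (F M.⊕ x) (M.⊆⊕ F x) (ℕ.≤-reflexive (sym rFx)))
    where
    rFx = M.r-⊕ F (M.flat⊆E G x∈G) x∉F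

  r-φ-mono : (F G : Flat M) → M.set F ⊆ M.set G →
    M.r (M.set G) + M′.r (M′.set (φ G)) ≤ M.r (M.set F) + M′.r (M′.set (φ F))
  r-φ-mono F G F⊆G = begin
    M.r (M.set G) + M′.r (M′.set (φ G))        ≡⟨ cong (_+ M′.r (M′.set (φ G))) eq ⟨
    k + M.r (M.set F) + M′.r (M′.set (φ G))    ≡⟨ xy∙z≈y∙xz k _ _ ⟩
    M.r (M.set F) + (k + M′.r (M′.set (φ G)))  ≤⟨ ℕ.+-monoʳ-≤ _ (r-φ-gap k F G F⊆G eq) ⟩
    M.r (M.set F) + M′.r (M′.set (φ F))        ∎
    where
    open ℕ.≤-Reasoning
    k = M.r (M.set G) ∸ M.r (M.set F)
    eq : k + M.r (M.set F) ≡ M.r (M.set G)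
    eq = ℕ.m∸n+n≡m (M.r-mono-⊆ F⊆G)

  -- By `r-φ-mono` the sum cannot grow with the flat. At the closure of the empty set it is at most
  -- `M′.rank`, which equals `M.rank`; at the closure of `M.E` it is at least `M.rank`.
  r-φ : ∀ F → M.r (M.set F) + M′.r (M′.set (φ F)) ≡ M.rank
  r-φ F = ℕ.≤-antisym
    (begin
      M.r (M.set F) + M′.r (M′.set (φ F))    ≤⟨ r-φ-mono bot F (M.cl⊆flat F (⊥-elim ∘ ∉⊥)) ⟩
      M.r (M.set bot) + M′.r (M′.set (φ bot)) ≡⟨ cong (_+ M′.r (M′.set (φ bot))) (trans (M.r-closure ⊥) M.r-⊥) ⟩
      M′.r (M′.set (φ bot))                   ≤⟨ M′.r-mono-⊆ (M′.flat⊆E (φ bot)) ⟩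
      M′.rank                                 ≡⟨ same-rank ⟩
      M.rank                                  ∎)
    (begin
      M.rank                                  ≡⟨ M.r-closure M.E ⟨
      M.r (M.set top)                         ≤⟨ ℕ.m≤m+n _ _ ⟩
      M.r (M.set top) + M′.r (M′.set (φ top)) ≤⟨ r-φ-mono F top (λ x∈ → M.⊆cl (M.flat⊆E F x∈) (M.flat⊆E F x∈)) ⟩
      M.r (M.set F) + M′.r (M′.set (φ F))     ∎)
    where
    open ℕ.≤-Reasoning
    bot = M.closure ⊥
    top = M.closure M.E

  r-φ-suc : ∀ F G → M.r (M.set G) ≡ suc (M.r (M.set F)) →
            M′.r (M′.set (φ F)) ≡ suc (M′.r (M′.set (φ G)))
  r-φ-suc F G eq = ℕ.+-cancelˡ-≡ (M.r (M.set F)) _ _ (begin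
    M.r (M.set F) + M′.r (M′.set (φ F))        ≡⟨ r-φ F ⟩
    M.rank                                     ≡⟨ r-φ G ⟨
    M.r (M.set G) + M′.r (M′.set (φ G))        ≡⟨ cong (_+ M′.r (M′.set (φ G))) eq ⟩
    suc (M.r (M.set F)) + M′.r (M′.set (φ G))  ≡⟨ ℕ.+-suc _ _ ⟨
    M.r (M.set F) + suc (M′.r (M′.set (φ G)))  ∎)
    where open ≡-Reasoning

  -- Reflecting inclusions of images of hyperplanes.

  module _ (H : Flat M) (h : M.IsHyperplane H) {e : Fin m} (e∈E : e ∈ M.E) (e∉H : e ∉ M.set H) where

    -- In the inductive step, enlarge F by a point a of H to G, which avoids e:
    -- if φ H lay under φ (F ⊕ e), then φ (F ⊕ e) and φ G would both be spanned
    -- by φ (G ⊕ e) and φ H, so F ⊕ e = G would lie in H.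
    φH⊈φ⊕ : ∀ k F → M.set F ⊆ M.set H → k + M.r (M.set F) ≡ M.r (M.set H) →
            M′.set (φ H) ⊈ M′.set (φ (F M.⊕ e))
    -- With no rank gap left `F` is `H` itself, and `φ H` has rank one more than `φ (F ⊕ e)`.
    φH⊈φ⊕ zero F F⊆H eq φH⊆ = ℕ.<-irrefl refl (begin-strict
      M′.r (M′.set (φ (F M.⊕ e)))        <⟨ ℕ.n<1+n _ ⟩
      suc (M′.r (M′.set (φ (F M.⊕ e))))  ≡⟨ r-φ-suc F (F M.⊕ e) (M.r-⊕ F e∈E (e∉H ∘ F⊆H)) ⟨
      M′.r (M′.set (φ F))                ≡⟨ cong (M′.r ∘ M′.set ∘ φ) (M.flat-⊆-rank F H F⊆H (ℕ.≤-reflexive (sym eq))) ⟩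
      M′.r (M′.set (φ H))                ≤⟨ M′.r-mono-⊆ φH⊆ ⟩
      M′.r (M′.set (φ (F M.⊕ e)))        ∎)
      where open ℕ.≤-Reasoning
    φH⊈φ⊕ (suc k) F F⊆H eq φH⊆ with M.r-<⇒∃∉ (subst (M.r (M.set F) <_) eq (s≤s (ℕ.m≤n+m _ k)))
    ... | a , a∈H , a∉F = e∉H (G⊆H (subst (λ Z → e ∈ M.set Z) F⊕e≡G (M.∈⊕ F e∈E)))
      where
      G = F M.⊕ a
      a∈E = M.flat⊆E H a∈H
      G⊆H = M.⊕⊆ F H F⊆H a∈H
      rG = M.r-⊕ F a∈E a∉F
      rF⊕e = M.r-⊕ F e∈E (e∉H ∘ F⊆H)
      rG⊕e = M.r-⊕ G e∈E (e∉H ∘ G⊆H)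
      F⊕e⊆G⊕e : M.set (F M.⊕ e) ⊆ M.set (G M.⊕ e)
      F⊕e⊆G⊕e = M.⊕⊆ F (G M.⊕ e) (M.⊆⊕ G e ∘ M.⊆⊕ F a) (M.∈⊕ G e∈E)
      F⊕e≡G : F M.⊕ e ≡ G
      -- The induction hypothesis at `G` supplies an element of `φ H` outside `φ (G ⊕ e)`, as
      -- `flats-agree` requires.
      F⊕e≡G = injective (M′.flats-agree (φ (G M.⊕ e)) (φ (F M.⊕ e)) (φ G)
        (φH⊈φ⊕ k G G⊆H (trans (cong (k +_) rG) (trans (ℕ.+-suc k _) eq)))
        (antitone {F M.⊕ e} {G M.⊕ e} F⊕e⊆G⊕e) φH⊆
        (antitone {G} {G M.⊕ e} (M.⊆⊕ G e)) (antitone {G} {H} G⊆H)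
        (r-φ-suc (F M.⊕ e) (G M.⊕ e) (trans rG⊕e (cong suc (trans rG (sym rF⊕e)))))
        (r-φ-suc G (G M.⊕ e) rG⊕e))

  -- A converse to `antitone` for hyperplanes. For `e` in `F` outside `H`, `antitone` places `φ F`,
  -- and with it `φ H`, under the image of the closure of `e`; `φH⊈φ⊕`, started at the bottom flat,
  -- forbids this.
  hyperplane-⊇ : ∀ F H → M.IsHyperplane H → M′.set (φ H) ⊆ M′.set (φ F) → M.set F ⊆ M.set H
  hyperplane-⊇ F H h φH⊆φF {e} e∈F with e ∈? M.set H
  ... | yes e∈H = e∈H
  ... | no  e∉H = ⊥-elim (φH⊈φ⊕ H h (M.flat⊆E F e∈F) e∉H (M.r (M.set H)) bot
    (M.cl⊆flat H (⊥-elim ∘ ∉⊥))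
    (trans (cong (M.r (M.set H) +_) (trans (M.r-closure ⊥) M.r-⊥)) (ℕ.+-identityʳ _))
    (antitone {bot M.⊕ e} {F} (M.⊕⊆ bot F (M.cl⊆flat F (⊥-elim ∘ ∉⊥)) e∈F) ∘ φH⊆φF))
    where bot = M.closure ⊥

-- The adjoint map on the contraction.

proposition3p1 : ∀ {m n} (M : Matroid m) (M′ : Matroid n) (φ : Flat M → Flat M′) →
    IsAdjointMap M M′ φ →
    (C : Subset m) → C ⊆ Matroid.E M →
    let X = Matroid.set M′ (φ (Matroid.closure M C)) in
    Σ[ φ/C ∈ (Flat (M / C) → Flat (M′ ↾ X)) ]
    IsAdjointMap (M / C) (M′ ↾ X) φ/C ×
    (∀ (F : Flat (M / C)) →
    let F∪C = Matroid.set (M / C) F ∪ C in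
    Σ[ F∪C-flat ∈ Matroid.IsFlat M F∪C ]
    Matroid.set (M′ ↾ X) (φ/C F) ≡ Matroid.set M′ (φ (F∪C , F∪C-flat)))
proposition3p1 {m} {n} M M′ φ adj C C⊆E = φ/C , isAdjoint , λ F → flat-/⁺ F , refl
  where
  module M  = Rank M
  module M′ = Rank M′
  module K  = Rank (M / C)
  open Adjoint {M = M} {M′} {φ} adj
  open Contraction M C⊆E

  X-flat : Flat M′
  X-flat = φ (M.closure C)

  X : Subset n
  X = M′.set X-flat

  module R = Rank (M′ ↾ X)
  open Restriction M′ X

  X⊆E : X ⊆ M′.E
  X⊆E = M′.flat⊆E X-flat

  φ⊆X : ∀ F → M′.set (φ (F ∪C)) ⊆ X
  φ⊆X F = antitone {M.closure C} {F ∪C} (M.cl⊆flat (F ∪C) (q⊆p∪q (K.set F) C))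

  φ/C : Flat (M / C) → Flat (M′ ↾ X)
  φ/C F = M′.set (φ (F ∪C)) , flat-↾⁺ (φ (F ∪C)) X⊆E (φ⊆X F)

  φ/C-injective : ∀ {F G} → φ/C F ≡ φ/C G → F ≡ G
  φ/C-injective {F} {G} eq =
    ∪C-injective {F} {G} (injective (M′.flat-≡ {φ (F ∪C)} {φ (G ∪C)} (cong R.set eq)))

  φ/C-point : ∀ {H} → K.IsHyperplane H → R.IsPoint (φ/C H)
  φ/C-point {H} h = trans (r-↾ (φ⊆X H)) (hyperplane⇒point {H ∪C} (hyperplane-∪C⁺ {H} h))

  -- Both ranks are `M.rank` less `M.r C`: the left by `r-φ` at the closure of `C`, the right by
  -- `rank-/`.
  φ/C-rank : R.rank ≡ K.rank
  φ/C-rank = ℕ.+-cancelʳ-≡ (M.r C) _ _ (begin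
    R.r X + M.r C                ≡⟨ cong (_+ M.r C) (r-↾ id) ⟩
    M′.r X + M.r C               ≡⟨ ℕ.+-comm (M′.r X) _ ⟩
    M.r C + M′.r X               ≡⟨ cong (_+ M′.r X) (M.r-closure C) ⟨
    M.r (M.cl C) + M′.r X        ≡⟨ r-φ (M.closure C) ⟩
    M.rank                       ≡⟨ rank-/ ⟨
    K.rank + M.r C               ∎)
    where open ≡-Reasoning

  restricted/C : ∃ K.IsHyperplane → ∃ R.IsPoint
  restricted/C (H , h) = φ/C H , φ/C-point {H} h

  point-≡ : {P Q : ∃ R.IsPoint} → proj₁ P ≡ proj₁ Q → P ≡ Q
  point-≡ {P , p} {_ , q} refl = cong (P ,_) (ℕ.≡-irrelevant p q)

  hyperplane-≡ : {P Q : ∃ K.IsHyperplane} → proj₁ P ≡ proj₁ Q → P ≡ Q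
  hyperplane-≡ {P , p} {_ , q} refl = cong (P ,_) (ℕ.≡-irrelevant p q)

  -- As `X` is a flat, `P` is also a point of `M′`, hence `φ H` for a hyperplane `H` of `M`. Since
  -- `φ H` lies in `X`, the image of the closure of `C`, `hyperplane-⊇` gives `C ⊆ M.set H`, and
  -- `M.set H ─ C` is the required hyperplane of `M / C`.
  preimage : ∀ P → R.IsPoint P → ∃[ H ] K.IsHyperplane H × φ/C H ≡ P
  preimage P isP = H/C , hyperplane-∪C⁻ {H/C} (subst M.IsHyperplane (sym H/C∪C≡H) h) ,
    R.flat-≡ {φ/C H/C} {P} (trans (cong (M′.set ∘ φ) H/C∪C≡H) φH≡P)
    where
    P⊆X = R.flat⊆E P
    P′ : Flat M′
    P′ = R.set P , flat-↾⁻ (proj₂ X-flat) P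
    found = proj₂ bijective (P′ , trans (sym (r-↾ P⊆X)) isP)
    H = proj₁ (proj₁ found)
    h : M.IsHyperplane H
    h = proj₂ (proj₁ found)
    φH≡P : M′.set (φ H) ≡ R.set P
    φH≡P = cong (M′.set ∘ proj₁) (proj₂ found refl)
    C⊆H : C ⊆ M.set H
    C⊆H x∈C = hyperplane-⊇ (M.closure C) H h
      (λ y∈ → P⊆X (subst (_ ∈_) φH≡P y∈)) (M.⊆cl (C⊆E x∈C) x∈C)
    H/C : Flat (M / C)
    H/C = M.set H ─ C , flat-/⁻ H C⊆H
    H/C∪C≡H : H/C ∪C ≡ H
    H/C∪C≡H = M.flat-≡ {H/C ∪C} {H} (─-∪-cancel C⊆H)

  φ/C-bijective : Bijective _≡_ _≡_ restricted/C
  φ/C-bijective =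
    (λ eq → hyperplane-≡ (φ/C-injective (cong proj₁ eq))) ,
    (λ (P , isP) → let H , h , eq = preimage P isP in (H , h) , λ { refl → point-≡ eq })

  isAdjoint : IsAdjointMap (M / C) (M′ ↾ X) φ/C
  isAdjoint = record
    { simple           = simple-↾ X⊆E simple
    ; same-rank        = φ/C-rank
    ; injective        = φ/C-injective
    ; antitone         = λ {F} {G} F⊆G → antitone {F ∪C} {G ∪C} (∪-mono-⊆ F⊆G id)
    ; hyperplane⇒point = λ {H} → φ/C-point {H}
    ; bijective        = φ/C-bijective
    }
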